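{- Let $Y$ be a contractible, locally finite $d$-dimensional simplicial complex and let $G =\{S_1, \dots, S_n\}$ be a good cover in $\|Y\|$. Suppose $K$ is a simplicial complex on $n$ vertices (with vertex set $[n]=\{1,\dots,n\}$) which is a subcomplex of the nerve of $G$. Then there exist an integer $m$, a family of convex sets $F = \{C_1, \dots, C_n\}$ in $\mathbb{R}^{m}$ and a continuous map $f \colon \mathbb{R}^{m} \to \|Y\|$ such that the following hold. (1) The nerve of $F$ equals $K$ (with $C_i$ corresponding to the vertex $i$). (2) For every $i\in [n]$ we have $f(C_i)\subset S_i$.
   Context: For a (locally finite) simplicial complex $Y$, $\|Y\|$ denotes its polyhedron: the underlying topological space, i.e. the union of its simplices with the topology induced by the geometric realization. A good cover in a topological space is a finite family of compact subsets of the space such that the intersection of any subfamily is either empty or contractible (the family is not required to cover the space). The nerve of a finite family $\{A_1,\dots,A_n\}$ is the simplicial complex whose faces are the sets $\sigma\subset[n]$ with $\bigcap_{i\in\sigma}A_i\neq\emptyset$. -}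

module Defs where

open import Algebra.Bundles using (CommutativeRing)
import Algebra.Properties.Ring as RingProperties
open import Axiom.ExcludedMiddle using (ExcludedMiddle)
open import Data.Empty using (⊥-elim)
open import Data.Fin.Base using (Fin)
open import Data.List.Base using (List; []; [_]; foldr; length; map)
open import Data.List.Membership.Propositional using (_∈_; _∉_)
open import Data.List.Relation.Binary.BagAndSetEquality using (_∼[_]_; set)
open import Data.List.Relation.Binary.Subset.Propositional using () renaming (_⊆_ to _⊆ₗ_)
open import Data.List.Relation.Unary.Any using (Any)
open import Data.List.Relation.Unary.Unique.Propositional using (Unique)
open import Data.Nat.Base as ℕ using (ℕ)
open import Data.Product.Base using (Σ; ∃; _×_; _,_; proj₁; proj₂)
open import Data.Product.Relation.Binary.Pointwise.NonDependent using (_×ₛ_)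
open import Data.Sum.Base using (_⊎_; inj₁; inj₂)
open import Data.Vec.Functional using (Vector)
import Data.Vec.Functional.Relation.Binary.Pointwise.Properties as Pointwise
open import Function.Base using (_∘_)
open import Function.Bundles using (Func)
open import Level using (0ℓ; Setω; suc)
open import Relation.Binary.Bundles using (Setoid)
open import Relation.Binary.Core using (Rel)
import Relation.Binary.Construct.NonStrictToStrict as ToStrict
import Relation.Binary.Construct.On as On
open import Relation.Binary.PropositionalEquality using (_≡_; _≢_)
open import Relation.Binary.Structures using (IsTotalOrder)
open import Relation.Nullary using (¬_)
open import Relation.Unary using (Pred; _⊆_; _≐_; _∩_; ⋃; U; Empty; Satisfiable)
open import Relation.Binary.Definitions using (_Respects_)

-- The mathematics is classical; since 'Dec P' for every type P also
-- selects an inhabitant of each nonempty type, this includes choice.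

Classical : Setω
Classical = ∀ {ℓ} → ExcludedMiddle ℓ

-- The real numbers are given, up to isomorphism, by the axioms of a
-- complete ordered field.

record Reals : Set₁ where
  infix 4 _≤_
  field
    commutativeRing : CommutativeRing 0ℓ 0ℓ

  open CommutativeRing commutativeRing public

  field
    _≤_          : Rel Carrier 0ℓ
    isTotalOrder : IsTotalOrder _≈_ _≤_
    0≉1          : ¬ (0# ≈ 1#)
    inverse      : ∀ x → ¬ (x ≈ 0#) → ∃ λ y → x * y ≈ 1#
    +-monoˡ-≤    : ∀ z {x y} → x ≤ y → x + z ≤ y + z
    *-nonneg     : ∀ {x y} → 0# ≤ x → 0# ≤ y → 0# ≤ x * y

  UpperBound : Pred Carrier 0ℓ → Pred Carrier 0ℓ
  UpperBound P b = ∀ x → P x → x ≤ b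

  field
    supremum : ∀ (P : Pred Carrier 0ℓ) → Satisfiable P → Satisfiable (UpperBound P) →
               ∃ λ s → UpperBound P s × (∀ b → UpperBound P b → s ≤ b)

  module ≤ = IsTotalOrder isTotalOrder
  open ToStrict _≈_ _≤_ public using (_<_)
  open RingProperties ring using (-1*x≈-x; -‿involutive; +-cancelˡ)

  0≤1 : 0# ≤ 1#
  0≤1 with ≤.total 0# 1#
  ... | inj₁ 0≤1# = 0≤1#
  ... | inj₂ 1≤0  = ≤.trans (*-nonneg 0≤-1 0≤-1) (≤.reflexive (trans (-1*x≈-x (- 1#)) (-‿involutive 1#)))
    where
    0≤-1 : 0# ≤ - 1#
    0≤-1 = ≤.trans (≤.reflexive (sym (-‿inverseʳ 1#)))
             (≤.trans (+-monoˡ-≤ (- 1#) 1≤0) (≤.reflexive (+-identityˡ (- 1#))))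

  +-monoʳ-≤ : ∀ z {x y} → x ≤ y → z + x ≤ z + y
  +-monoʳ-≤ z {x} {y} x≤y = ≤.trans (≤.reflexive (+-comm z x))
    (≤.trans (+-monoˡ-≤ z x≤y) (≤.reflexive (+-comm y z)))

  <-≤-trans : ∀ {x y z} → x < y → y ≤ z → x < z
  <-≤-trans = ToStrict.<-≤-trans _≈_ _≤_ sym ≤.trans ≤.antisym ≤.≤-respʳ-≈

  -- ∣ x - y ∣ < ε
  Near : Carrier → Rel Carrier 0ℓ
  Near ε x y = x < y + ε × y < x + ε

  near-refl : ∀ {ε x y} → 0# < ε → x ≈ y → Near ε x y
  near-refl 0<ε x≈y = lt x≈y , lt (sym x≈y)
    where
    lt : ∀ {x y} → x ≈ y → x < y + _
    lt {x} {y} x≈y =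
      ≤.trans (≤.reflexive (trans x≈y (sym (+-identityʳ y)))) (+-monoʳ-≤ y (proj₁ 0<ε)) ,
      λ x≈y+ε → proj₂ 0<ε (+-cancelˡ y _ _ (trans (+-identityʳ y) (trans (sym x≈y) x≈y+ε)))

  near-mono : ∀ {δ ε x y} → δ ≤ ε → Near δ x y → Near ε x y
  near-mono δ≤ε (p , q) = <-≤-trans p (+-monoʳ-≤ _ δ≤ε) , <-≤-trans q (+-monoʳ-≤ _ δ≤ε)

  sum : List Carrier → Carrier
  sum = foldr _+_ 0#

-- Points are taken up to a setoid equality.

record Space : Set₂ where
  field
    setoid : Setoid 0ℓ 0ℓ

  open Setoid setoid public using (Carrier; _≈_)

  field
    Open     : Pred Carrier 0ℓ → Set₁
    respects : ∀ {P} → Open P → P Respects _≈_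
    ext      : ∀ {P Q} → P ≐ Q → Open P → Open Q
    open-U   : Open U
    open-∩   : ∀ {P Q} → Open P → Open Q → Open (P ∩ Q)
    open-⋃   : ∀ {I : Set} {P : I → Pred Carrier 0ℓ} → (∀ i → Open (P i)) → Open (⋃ I P)

open Space using (Carrier; _≈_; Open)

record Continuous (X Y : Space) : Set₁ where
  field
    func     : Func (Space.setoid X) (Space.setoid Y)
  open Func func public
  field
    preimage : ∀ {P} → Open Y P → Open X (P ∘ to)

subspace : (X : Space) → Pred (Carrier X) 0ℓ → Space
subspace X A = record
  { setoid   = On.setoid X.setoid (proj₁ {B = A})
  ; Open     = λ P → ∃ λ Q → X.Open Q × P ≐ (Q ∘ proj₁)
  ; respects = λ (_ , oQ , P⊆Q , Q⊆P) x≈y → Q⊆P ∘ X.respects oQ x≈y ∘ P⊆Q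
  ; ext      = λ (P⊆P′ , P′⊆P) (Q , oQ , P⊆Q , Q⊆P) → Q , oQ , P⊆Q ∘ P′⊆P , P⊆P′ ∘ Q⊆P
  ; open-U   = U , X.open-U , _ , _
  ; open-∩   = λ (Q , oQ , P⊆Q , Q⊆P) (Q′ , oQ′ , P′⊆Q′ , Q′⊆P′) →
                 Q ∩ Q′ , X.open-∩ oQ oQ′ ,
                 (λ (p , p′) → P⊆Q p , P′⊆Q′ p′) , (λ (q , q′) → Q⊆P q , Q′⊆P′ q′)
  ; open-⋃   = λ o → ⋃ _ (proj₁ ∘ o) , X.open-⋃ (proj₁ ∘ proj₂ ∘ o) ,
                 (λ (i , p) → i , proj₁ (proj₂ (proj₂ (o i))) p) ,
                 (λ (i , q) → i , proj₂ (proj₂ (proj₂ (o i))) q)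
  }
  where module X = Space X

infixr 2 _×ᵗ_

_×ᵗ_ : Space → Space → Space
X ×ᵗ Y = record
  { setoid   = X.setoid ×ₛ Y.setoid
  ; Open     = λ W → ∀ {x y} → W (x , y) → Box W x y
  ; respects = λ oW (x≈x′ , y≈y′) w →
                 let _ , _ , oP , oQ , p , q , PQ⊆W = oW w
                 in PQ⊆W (X.respects oP x≈x′ p) (Y.respects oQ y≈y′ q)
  ; ext      = λ (W⊆W′ , W′⊆W) oW w →
                 let P , Q , oP , oQ , p , q , PQ⊆W = oW (W′⊆W w)
                 in P , Q , oP , oQ , p , q , λ p′ q′ → W⊆W′ (PQ⊆W p′ q′)
  ; open-U   = λ _ → U , U , X.open-U , Y.open-U , _
  ; open-∩   = λ oW oW′ (w , w′) →
                 let P , Q , oP , oQ , p , q , PQ⊆W = oW w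
                     P′ , Q′ , oP′ , oQ′ , p′ , q′ , PQ′⊆W′ = oW′ w′
                 in P ∩ P′ , Q ∩ Q′ , X.open-∩ oP oP′ , Y.open-∩ oQ oQ′ , (p , p′) , (q , q′) ,
                    λ (a , a′) (b , b′) → PQ⊆W a b , PQ′⊆W′ a′ b′
  ; open-⋃   = λ o (i , w) →
                 let P , Q , oP , oQ , p , q , PQ⊆W = o i w
                 in P , Q , oP , oQ , p , q , λ a b → i , PQ⊆W a b
  }
  where
  module X = Space X
  module Y = Space Y
  Box : Pred (X.Carrier × Y.Carrier) 0ℓ → X.Carrier → Y.Carrier → Set₁
  Box W x y = ∃ λ P → ∃ λ Q → X.Open P × Y.Open Q × P x × Q y × (∀ {a b} → P a → Q b → W (a , b))

Compact : (X : Space) → Pred (Carrier X) 0ℓ → Set₁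
Compact X A = ∀ (I : Set) (P : I → Pred (Carrier X) 0ℓ) → (∀ i → Open X (P i)) →
              A ⊆ ⋃ I P → ∃ λ (js : List I) → ∀ {x} → A x → Any (λ j → P j x) js

-- Simplices are nonempty finite sets, given as lists up to having the
-- same members ('downClosed' makes 'Face' insensitive to order and
-- repetition).  The vertices are those v with 'Face [ v ]'.

record SimplicialComplex (V : Set) : Set₁ where
  field
    Face       : Pred (List V) 0ℓ
    nonempty   : ∀ {σ} → Face σ → σ ≢ []
    downClosed : ∀ {σ τ} → τ ≢ [] → τ ⊆ₗ σ → Face σ → Face τ

open SimplicialComplex using (Face)

HasVertexSetAll : ∀ {V} → SimplicialComplex V → Set
HasVertexSetAll {V} K = ∀ (v : V) → Face K [ v ]

IsSubcomplex : ∀ {V} → SimplicialComplex V → SimplicialComplex V → Set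
IsSubcomplex K L = Face K ⊆ Face L

SameComplex : ∀ {V} → SimplicialComplex V → SimplicialComplex V → Set
SameComplex K L = Face K ≐ Face L

LocallyFinite : ∀ {V} → SimplicialComplex V → Set
LocallyFinite {V} Y = ∀ (v : V) → ∃ λ (τs : List (List V)) →
  ∀ {σ} → Face Y σ → v ∈ σ → Any (λ τ → σ ∼[ set ] τ) τs

HasDimension : ∀ {V} → SimplicialComplex V → ℕ → Set
HasDimension Y d =
  (∀ {σ} → Face Y σ → Unique σ → length σ ℕ.≤ ℕ.suc d) ×
  (∃ λ σ → Face Y σ × Unique σ × length σ ≡ ℕ.suc d)

⋂[_] : ∀ {X I : Set} → List I → (I → Pred X 0ℓ) → Pred X 0ℓ
⋂[ σ ] A = λ x → ∀ {i} → i ∈ σ → A i x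

Nerve : ∀ {X : Set} {n} → (Fin n → Pred X 0ℓ) → SimplicialComplex (Fin n)
Nerve A = record
  { Face       = λ σ → σ ≢ [] × Satisfiable (⋂[ σ ] A)
  ; nonempty   = proj₁
  ; downClosed = λ τ≢[] τ⊆σ (_ , x , x∈) → τ≢[] , x , λ i∈τ → x∈ (τ⊆σ i∈τ)
  }

module _ (ℝ : Reals) where
  private module ℝ = Reals ℝ
  open ℝ using (_≤_; _<_; 0#; 1#; Near)

  -- The topology in which P is open when it contains some 'Ball ε x',
  -- ε > 0, around each of its points x.

  ballSpace : (S : Setoid 0ℓ 0ℓ) (Ball : ℝ.Carrier → Rel (Setoid.Carrier S) 0ℓ) →
              (∀ {ε x y} → 0# < ε → Setoid._≈_ S x y → Ball ε x y) →
              (∀ {δ ε x y} → δ ≤ ε → Ball δ x y → Ball ε x y) → Space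
  ballSpace S Ball centre mono = record
    { setoid   = S
    ; Open     = λ P → Level.Lift (suc 0ℓ) (IsOpen P)
    ; respects = λ (Level.lift oP) x≈y p → let _ , 0<ε , B⊆P = oP p in B⊆P (centre 0<ε x≈y)
    ; ext      = λ (P⊆Q , Q⊆P) (Level.lift oP) → Level.lift λ q →
                   let ε , 0<ε , B⊆P = oP (Q⊆P q) in ε , 0<ε , λ b → P⊆Q (B⊆P b)
    ; open-U   = Level.lift λ _ → 1# , (ℝ.0≤1 , ℝ.0≉1) , _
    ; open-∩   = λ (Level.lift oP) (Level.lift oQ) → Level.lift λ (p , q) → meet (oP p) (oQ q)
    ; open-⋃   = λ o → Level.lift λ (i , p) →
                   let ε , 0<ε , B⊆P = Level.lower (o i) p in ε , 0<ε , λ b → i , B⊆P b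
    }
    where
    Nbhd : Pred (Setoid.Carrier S) 0ℓ → Pred (Setoid.Carrier S) 0ℓ
    Nbhd P x = ∃ λ ε → 0# < ε × (∀ {y} → Ball ε x y → P y)

    IsOpen : Pred (Setoid.Carrier S) 0ℓ → Set
    IsOpen P = P ⊆ Nbhd P

    meet : ∀ {P Q x} → Nbhd P x → Nbhd Q x → Nbhd (P ∩ Q) x
    meet (δ , 0<δ , B⊆P) (ε , 0<ε , B⊆Q) with ℝ.≤.total δ ε
    ... | inj₁ δ≤ε = δ , 0<δ , λ b → B⊆P b , B⊆Q (mono δ≤ε b)
    ... | inj₂ ε≤δ = ε , 0<ε , λ b → B⊆P (mono ε≤δ b) , B⊆Q b

  Line : Space
  Line = ballSpace ℝ.setoid Near ℝ.near-refl ℝ.near-mono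

  UnitInterval : Space
  UnitInterval = subspace Line (λ t → 0# ≤ t × t ≤ 1#)

  Euclidean : ℕ → Space
  Euclidean m = ballSpace (Pointwise.setoid ℝ.setoid m)
    (λ ε x y → ∀ i → Near ε (x i) (y i))
    (λ 0<ε x≈y i → ℝ.near-refl 0<ε (x≈y i))
    (λ δ≤ε b i → ℝ.near-mono δ≤ε (b i))

  record IsConvexSet {m} (C : Pred (Vector ℝ.Carrier m) 0ℓ) : Set where
    field
      respects : C Respects (_≈_ (Euclidean m))
      convex   : ∀ {x y} → C x → C y → ∀ {t} → 0# ≤ t → t ≤ 1# →
                 C (λ i → (1# ℝ.- t) ℝ.* x i ℝ.+ t ℝ.* y i)

  record Contractible (X : Space) : Set₁ where
    field
      centre   : Carrier X
      homotopy : Continuous (X ×ᵗ UnitInterval) X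

    open Continuous homotopy using (to)

    field
      at-0 : ∀ x → _≈_ X (to (x , 0# , ℝ.≤.refl , ℝ.0≤1)) x
      at-1 : ∀ x → _≈_ X (to (x , 1# , ℝ.0≤1 , ℝ.≤.refl)) centre

  record IsGoodCover (X : Space) {n} (S : Fin n → Pred (Carrier X) 0ℓ) : Set₁ where
    field
      respects     : ∀ i → S i Respects (_≈_ X)
      compact      : ∀ i → Compact X (S i)
      intersection : ∀ σ → σ ≢ [] →
                     Empty (⋂[ σ ] S) ⊎ Contractible (subspace X (⋂[ σ ] S))

  -- Points of the polyhedron in barycentric coordinates.

  record Point {V : Set} (Y : SimplicialComplex V) : Set where
    field
      coord     : V → ℝ.Carrier
      support   : List V
      face      : Face Y support
      unique    : Unique support
      nonneg    : ∀ v → 0# ≤ coord v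
      vanishing : ∀ {v} → v ∉ support → coord v ℝ.≈ 0#
      total     : ℝ.sum (map coord support) ℝ.≈ 1#

  open Point using (coord)

  module _ {V : Set} (Y : SimplicialComplex V) where

    pointSetoid : Setoid 0ℓ 0ℓ
    pointSetoid = record
      { Carrier       = Point Y
      ; _≈_           = λ x y → ∀ v → coord x v ℝ.≈ coord y v
      ; isEquivalence = record
        { refl  = λ _ → ℝ.refl
        ; sym   = λ x≈y v → ℝ.sym (x≈y v)
        ; trans = λ x≈y y≈z v → ℝ.trans (x≈y v) (y≈z v)
        }
      }

    InSimplex : List V → Pred (Point Y) 0ℓ
    InSimplex σ x = ∀ {v} → v ∉ σ → coord x v ℝ.≈ 0#

    simplex : List V → Space
    simplex σ = ballSpace (On.setoid pointSetoid (proj₁ {B = InSimplex σ}))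
      (λ ε (x , _) (y , _) → ∀ {v} → v ∈ σ → Near ε (coord x v) (coord y v))
      (λ 0<ε x≈y {v} _ → ℝ.near-refl 0<ε (x≈y v))
      (λ δ≤ε b v∈σ → ℝ.near-mono δ≤ε (b v∈σ))

    -- The coherent topology: a set is open when its trace on every
    -- closed simplex is.

    polyhedron : Space
    polyhedron = record
      { setoid   = pointSetoid
      ; Open     = λ P → ∀ {σ} → Face Y σ → Open (simplex σ) (P ∘ proj₁)
      ; respects = λ oP {x} x≈y →
                     Space.respects (simplex (Point.support x)) (oP (Point.face x))
                       {x , Point.vanishing x}
                       {_ , λ v∉ → ℝ.trans (ℝ.sym (x≈y _)) (Point.vanishing x v∉)}
                       x≈y
      ; ext      = λ (P⊆Q , Q⊆P) oP {σ} f → Space.ext (simplex σ) (P⊆Q , Q⊆P) (oP f)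
      ; open-U   = λ {σ} _ → Space.open-U (simplex σ)
      ; open-∩   = λ oP oQ {σ} f → Space.open-∩ (simplex σ) (oP f) (oQ f)
      ; open-⋃   = λ o {σ} f → Space.open-⋃ (simplex σ) (λ i → o i f)
      }

{-# OPTIONS --safe #-}
module Submission where

-- The convex sets live in ℝⁿ.  Cᵢ is cut out by xᵢ ≥ top and, for every
-- nonface τ of K, by Σ_{j∈τ} xⱼ ≤ -1; the latter forbids τ ⊆ {j | xⱼ ≥ 0},
-- so the nerve of C is K.  After subtracting the largest violation
-- ('defect') of the latter inequalities from all coordinates, every point
-- of ℝⁿ has the property that its superlevel sets at thresholds
-- 0 = b₀ < b₁ < … < bₙ are faces σ₀ ⊇ σ₁ ⊇ … ⊇ σₙ of K, possibly empty.
--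
-- The map runs the contractions of ⋂_{i∈σ₀} Sᵢ, ⋂_{i∈σ₁} Sᵢ, … one after
-- the other, where ⋂ over ∅ is the whole space.  This makes sense since
-- these sets increase.  The time spent in the k-th contraction is 0 when
-- some coordinate is close to bₖ, which hides the jumps of σₖ.  There are
-- more thresholds than coordinates, so at some k no coordinate is close to
-- bₖ: that contraction is run completely and sends everything to a centre,
-- which makes the map continuous whatever happened before.

open import Defs
import Algebra.Construct.NaturalChoice.Max as Max
import Algebra.Construct.NaturalChoice.Min as Min
import Algebra.Solver.Ring.NaturalCoefficients.Default as SemiringSolver
open import Data.Empty using (⊥; ⊥-elim)
open import Data.Fin.Base as Fin using (Fin; toℕ)
open import Data.Fin.Properties using (pigeonhole; ¬∀⟶∃¬; toℕ<n)
open import Data.List.Base using (List; []; _∷_; [_]; _++_; allFin; filter; foldr; map)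
open import Data.List.Membership.Propositional using (_∈_; _∉_)
open import Data.List.Membership.Propositional.Properties
  using (∈-++⁺ˡ; ∈-++⁺ʳ; ∈-allFin; ∈-filter⁺; ∈-filter⁻; ∈-map⁺)
open import Data.List.Properties using (filter-≐)
open import Data.List.Relation.Unary.Any using (here; there)
open import Data.Nat.Base as ℕ using (ℕ; zero; suc)
import Data.Nat.Properties as ℕ
open import Data.Product.Base using (Σ; ∃; _×_; _,_; proj₁; proj₂)
open import Data.Sum.Base using (_⊎_; inj₁; inj₂)
open import Data.Vec.Functional using (Vector)
open import Function.Base using (_∘_)
open import Level using (0ℓ; lift)
open import Relation.Binary.Bundles using (Setoid; TotalOrder)
open import Relation.Binary.Definitions using (_Respects_)
open import Relation.Binary.PropositionalEquality as ≡ using (_≡_; _≢_)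
import Relation.Binary.Reasoning.PartialOrder as OrderReasoning
open import Relation.Nullary using (yes; no; ¬_; contradiction)
open import Relation.Unary using (Pred; Decidable; Empty)

-- Arithmetic, finite maxima, minima and sums in an ordered field.

module OrderedField (em : Classical) (ℝ : Reals) where
  open Reals ℝ

  totalOrder : TotalOrder 0ℓ 0ℓ 0ℓ
  totalOrder = record { isTotalOrder = isTotalOrder }

  open Max totalOrder public using (_⊔_; x≤x⊔y; x≤y⊔x; ⊔-lub)
  open Min totalOrder public using (_⊓_; x⊓y≤x; x⊓y≤y; ⊓-glb)
  open OrderReasoning (TotalOrder.poset totalOrder) public
  open SemiringSolver commutativeSemiring

  <⇒≱ : ∀ {x y} → x < y → ¬ (y ≤ x)
  <⇒≱ (x≤y , x≉y) y≤x = x≉y (≤.antisym x≤y y≤x)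

  ≰⇒> : ∀ {x y} → ¬ (x ≤ y) → y < x
  ≰⇒> {x} {y} x≰y with ≤.total x y
  ... | inj₁ x≤y = contradiction x≤y x≰y
  ... | inj₂ y≤x = y≤x , λ y≈x → x≰y (≤.reflexive (sym y≈x))

  ≤-<-trans : ∀ {x y z} → x ≤ y → y < z → x < z
  ≤-<-trans x≤y y<z = begin-strict _ ≤⟨ x≤y ⟩ _ <⟨ y<z ⟩ _ ∎

  0<1 : 0# < 1#
  0<1 = 0≤1 , 0≉1

  x≤x+y : ∀ {x y} → 0# ≤ y → x ≤ x + y
  x≤x+y {x} {y} 0≤y = begin
    x      ≈⟨ +-identityʳ x ⟨
    x + 0# ≤⟨ +-monoʳ-≤ x 0≤y ⟩
    x + y  ∎

  +-mono-≤ : ∀ {w x y z} → w ≤ x → y ≤ z → w + y ≤ x + z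
  +-mono-≤ w≤x y≤z = ≤.trans (+-monoˡ-≤ _ w≤x) (+-monoʳ-≤ _ y≤z)

  x+y-y≈x : ∀ x y → x + y - y ≈ x
  x+y-y≈x x y = trans (+-assoc x y (- y)) (trans (+-congˡ (-‿inverseʳ y)) (+-identityʳ x))

  x-y+y≈x : ∀ x y → x - y + y ≈ x
  x-y+y≈x x y = trans (+-assoc x (- y) y) (trans (+-congˡ (-‿inverseˡ y)) (+-identityʳ x))

  +-cancelʳ-≤ : ∀ z {x y} → x + z ≤ y + z → x ≤ y
  +-cancelʳ-≤ z {x} {y} x+z≤y+z = begin
    x         ≈⟨ x+y-y≈x x z ⟨
    x + z - z ≤⟨ +-monoˡ-≤ (- z) x+z≤y+z ⟩
    y + z - z ≈⟨ x+y-y≈x y z ⟩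
    y         ∎

  +-monoˡ-< : ∀ z {x y} → x < y → x + z < y + z
  +-monoˡ-< z x<y = ≰⇒> (<⇒≱ x<y ∘ +-cancelʳ-≤ z)

  +-cancelʳ-< : ∀ z {x y} → x + z < y + z → x < y
  +-cancelʳ-< z x+z<y+z = ≰⇒> (<⇒≱ x+z<y+z ∘ +-monoˡ-≤ z)

  +-monoʳ-< : ∀ z {x y} → x < y → z + x < z + y
  +-monoʳ-< z {x} {y} x<y = begin-strict
    z + x ≈⟨ +-comm z x ⟩
    x + z <⟨ +-monoˡ-< z x<y ⟩
    y + z ≈⟨ +-comm y z ⟩
    z + y ∎

  +-mono-< : ∀ {w x y z} → w < x → y < z → w + y < x + z
  +-mono-< {w} {x} {y} {z} w<x y<z = begin-strict
    w + y <⟨ +-monoˡ-< y w<x ⟩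
    x + y <⟨ +-monoʳ-< x y<z ⟩
    x + z ∎

  x<x+y : ∀ {x y} → 0# < y → x < x + y
  x<x+y {x} {y} 0<y = begin-strict
    x      ≈⟨ +-identityʳ x ⟨
    x + 0# <⟨ +-monoʳ-< x 0<y ⟩
    x + y  ∎

  x≤z-y : ∀ {x y z} → x + y ≤ z → x ≤ z - y
  x≤z-y {x} {y} {z} x+y≤z = +-cancelʳ-≤ y (≤.trans x+y≤z (≤.reflexive (sym (x-y+y≈x z y))))

  x-y≤0 : ∀ {x y} → x ≤ y → x - y ≤ 0#
  x-y≤0 {x} {y} x≤y = ≤.trans (+-monoˡ-≤ (- y) x≤y) (≤.reflexive (-‿inverseʳ y))

  0<y-x : ∀ {x y} → x < y → 0# < y - x
  0<y-x {x} {y} x<y = begin-strict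
    0#    ≈⟨ -‿inverseʳ x ⟨
    x - x <⟨ +-monoˡ-< (- x) x<y ⟩
    y - x ∎

  x+[y-x]≈y : ∀ x y → x + (y - x) ≈ y
  x+[y-x]≈y x y = trans (+-comm x (y - x)) (x-y+y≈x y x)

  *-monoˡ-≤ : ∀ {s x y} → 0# ≤ s → x ≤ y → s * x ≤ s * y
  *-monoˡ-≤ {s} {x} {y} 0≤s x≤y = begin
    s * x               ≤⟨ x≤x+y (*-nonneg 0≤s (x≤z-y (≤.trans (≤.reflexive (+-identityˡ x)) x≤y))) ⟩
    s * x + s * (y - x) ≈⟨ distribˡ s x (y - x) ⟨
    s * (x + (y - x))   ≈⟨ *-congˡ (x+[y-x]≈y x y) ⟩
    s * y               ∎

  half : ∀ {ε} → 0# < ε → ∃ λ δ → 0# < δ × δ + δ ≈ ε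
  half {ε} 0<ε = ε * h , (0≤εh , 0≉εh) , sum≈
    where
    0<2 : 0# < 1# + 1#
    0<2 = <-≤-trans 0<1 (x≤x+y 0≤1)
    inv = inverse (1# + 1#) (proj₂ 0<2 ∘ sym)
    h = proj₁ inv
    2h≈1 : h + h ≈ 1#
    2h≈1 = trans (solve 1 (λ h → h :+ h := (con 1 :+ con 1) :* h) refl h) (proj₂ inv)
    0≤h : 0# ≤ h
    0≤h with ≤.total 0# h
    ... | inj₁ 0≤h = 0≤h
    ... | inj₂ h≤0 = contradiction
      (begin 1# ≈⟨ 2h≈1 ⟨ h + h ≤⟨ +-mono-≤ h≤0 h≤0 ⟩ 0# + 0# ≈⟨ +-identityˡ 0# ⟩ 0# ∎)
      (<⇒≱ 0<1)
    0≤εh : 0# ≤ ε * h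
    0≤εh = *-nonneg (proj₁ 0<ε) 0≤h
    sum≈ : ε * h + ε * h ≈ ε
    sum≈ = trans (sym (distribˡ ε h h)) (trans (*-congˡ 2h≈1) (*-identityʳ ε))
    0≉εh : ¬ (0# ≈ ε * h)
    0≉εh 0≈εh = proj₂ 0<ε (trans (sym (+-identityˡ 0#)) (trans (+-cong 0≈εh 0≈εh) sum≈))

  ≤+ε⇒≤ : ∀ {x y} → (∀ {ε} → 0# < ε → x < y + ε) → x ≤ y
  ≤+ε⇒≤ {x} {y} x<y+ε with em {P = x ≤ y}
  ... | yes x≤y = x≤y
  ... | no  x≰y = contradiction (≤.reflexive (x+[y-x]≈y y x)) (<⇒≱ (x<y+ε (0<y-x (≰⇒> x≰y))))

  mix : ∀ {t c} → (1# - t) * c + t * c ≈ c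
  mix {t} {c} = begin-equality
    (1# - t) * c + t * c ≈⟨ distribʳ c (1# - t) t ⟨
    (1# - t + t) * c     ≈⟨ *-congʳ (x-y+y≈x 1# t) ⟩
    1# * c               ≈⟨ *-identityˡ c ⟩
    c                    ∎

  mix-mono : ∀ {t w x y z} → 0# ≤ t → t ≤ 1# → w ≤ x → y ≤ z →
             (1# - t) * w + t * y ≤ (1# - t) * x + t * z
  mix-mono 0≤t t≤1 w≤x y≤z =
    +-mono-≤ (*-monoˡ-≤ (x≤z-y (≤.trans (≤.reflexive (+-identityˡ _)) t≤1)) w≤x) (*-monoˡ-≤ 0≤t y≤z)

  module _ {A : Set} (f : A → Carrier) where

    -- The base value 0 makes `defect` nonnegative, and defines it also when there are no nonfaces.
    max₀ : List A → Carrier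
    max₀ = foldr (λ a r → f a ⊔ r) 0#

    0≤max₀ : ∀ as → 0# ≤ max₀ as
    0≤max₀ []       = ≤.refl
    0≤max₀ (a ∷ as) = ≤.trans (0≤max₀ as) (x≤y⊔x (f a) (max₀ as))

    ≤max₀ : ∀ {a as} → a ∈ as → f a ≤ max₀ as
    ≤max₀ {a} {_ ∷ as} (here ≡.refl) = x≤x⊔y (f a) (max₀ as)
    ≤max₀ {a} {b ∷ as} (there a∈as)  = ≤.trans (≤max₀ a∈as) (x≤y⊔x (f b) (max₀ as))

    max₀≤0 : ∀ as → (∀ {a} → a ∈ as → f a ≤ 0#) → max₀ as ≤ 0#
    max₀≤0 []       _   = ≤.refl
    max₀≤0 (a ∷ as) f≤0 = ⊔-lub (f≤0 (here ≡.refl)) (max₀≤0 as (f≤0 ∘ there))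

    -- The base value 1 caps `time` at 1, also when there are no coordinates.
    min₁ : List A → Carrier
    min₁ = foldr (λ a r → f a ⊓ r) 1#

    min₁≤1 : ∀ as → min₁ as ≤ 1#
    min₁≤1 []       = ≤.refl
    min₁≤1 (a ∷ as) = ≤.trans (x⊓y≤y (f a) (min₁ as)) (min₁≤1 as)

    min₁≤ : ∀ {a as} → a ∈ as → min₁ as ≤ f a
    min₁≤ {a} {_ ∷ as} (here ≡.refl) = x⊓y≤x (f a) (min₁ as)
    min₁≤ {a} {b ∷ as} (there a∈as)  = ≤.trans (x⊓y≤y (f b) (min₁ as)) (min₁≤ a∈as)

    1≤min₁ : ∀ as → (∀ a → 1# ≤ f a) → 1# ≤ min₁ as
    1≤min₁ []       _   = ≤.refl
    1≤min₁ (a ∷ as) 1≤f = ⊓-glb (1≤f a) (1≤min₁ as 1≤f)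

  module _ {A : Set} where

    sum-mono-≤ : ∀ {f g : A → Carrier} → (∀ a → f a ≤ g a) → ∀ as → sum (map f as) ≤ sum (map g as)
    sum-mono-≤ f≤g []       = ≤.refl
    sum-mono-≤ f≤g (a ∷ as) = +-mono-≤ (f≤g a) (sum-mono-≤ f≤g as)

    sum-nonneg : ∀ {f : A → Carrier} as → (∀ {a} → a ∈ as → 0# ≤ f a) → 0# ≤ sum (map f as)
    sum-nonneg []       0≤f = ≤.refl
    sum-nonneg (a ∷ as) 0≤f = ≤.trans (0≤f (here ≡.refl)) (x≤x+y (sum-nonneg as (0≤f ∘ there)))

    ≤sum : ∀ {f : A → Carrier} {c} as → as ≢ [] → 0# ≤ c → (∀ {a} → a ∈ as → c ≤ f a) →
           c ≤ sum (map f as)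
    ≤sum []       as≢[] _   _   = contradiction ≡.refl as≢[]
    ≤sum (a ∷ as) _     0≤c c≤f =
      ≤.trans (c≤f (here ≡.refl)) (x≤x+y (sum-nonneg as (≤.trans 0≤c ∘ c≤f ∘ there)))

    -- One occurrence of `a` keeps its value `f a` and all other entries are raised to `g`; the
    -- extra term `g a` on the right is nonnegative. In this way a single very negative entry can
    -- outweigh the rest of a sum.
    sum≤ : ∀ {f g : A → Carrier} {a as} → a ∈ as → (∀ b → 0# ≤ g b) → (∀ b → f b ≤ g b) →
           sum (map f as) ≤ f a + sum (map g as)
    sum≤ {as = _ ∷ as} (here ≡.refl) 0≤g f≤g = +-monoʳ-≤ _
      (≤.trans (sum-mono-≤ f≤g as) (≤.trans (x≤x+y (0≤g _)) (≤.reflexive (+-comm _ _))))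
    sum≤ {f} {g} {a} {b ∷ as} (there a∈as) 0≤g f≤g = begin
      f b + sum (map f as)         ≤⟨ +-mono-≤ (f≤g b) (sum≤ a∈as 0≤g f≤g) ⟩
      g b + (f a + sum (map g as)) ≈⟨ solve 3 (λ x y z → x :+ (y :+ z) := y :+ (x :+ z)) refl _ _ _ ⟩
      f a + (g b + sum (map g as)) ∎

    sum-mix : ∀ s t (f g : A → Carrier) as →
              sum (map (λ a → s * f a + t * g a) as) ≈ s * sum (map f as) + t * sum (map g as)
    sum-mix s t f g []       = sym (trans (+-cong (zeroʳ s) (zeroʳ t)) (+-identityˡ 0#))
    sum-mix s t f g (a ∷ as) = trans (+-congˡ (sum-mix s t f g as))
      (solve 6 (λ s t x y p q → (s :* x :+ t :* y) :+ (s :* p :+ t :* q) :=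
                                s :* (x :+ p) :+ t :* (y :+ q)) refl s t (f a) (g a) _ _)

-- Continuity of real-valued functions on ℝⁿ.

module RealFunctions (em : Classical) (ℝ : Reals) (n : ℕ) where
  open Reals ℝ
  open OrderedField em ℝ

  Vec : Set
  Vec = Vector Carrier n

  -- This is the neighbourhood condition of `Euclidean`, so openness of a preimage unfolds to an
  -- `Eventually` at each of its points.
  Eventually : Vec → Pred Vec 0ℓ → Set
  Eventually x P = ∃ λ ε → 0# < ε × (∀ {y} → (∀ i → Near ε (x i) (y i)) → P y)

  module _ {x : Vec} where

    always : ∀ {P : Pred Vec 0ℓ} → (∀ y → P y) → Eventually x P
    always p = 1# , 0<1 , λ _ → p _

    eventually-self : ∀ {P} → Eventually x P → P x
    eventually-self (_ , 0<ε , p) = p λ _ → near-refl 0<ε refl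

    eventually-map : ∀ {P Q : Pred Vec 0ℓ} → (∀ {y} → P y → Q y) → Eventually x P → Eventually x Q
    eventually-map f (ε , 0<ε , p) = ε , 0<ε , λ near → f (p near)

    eventually₂ : ∀ {P Q R : Pred Vec 0ℓ} → (∀ {y} → P y → Q y → R y) →
                  Eventually x P → Eventually x Q → Eventually x R
    eventually₂ f (δ , 0<δ , p) (ε , 0<ε , q) with ≤.total δ ε
    ... | inj₁ δ≤ε = δ , 0<δ , λ near → f (p near) (q λ i → near-mono δ≤ε (near i))
    ... | inj₂ ε≤δ = ε , 0<ε , λ near → f (p λ i → near-mono ε≤δ (near i)) (q near)

    eventually-all : ∀ {m} {P : Fin m → Pred Vec 0ℓ} → (∀ i → Eventually x (P i)) →
                     Eventually x (λ y → ∀ i → P i y)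
    eventually-all {zero}  _ = always λ _ ()
    eventually-all {suc m} p = eventually₂ (λ { p₀ ps Fin.zero → p₀ ; p₀ ps (Fin.suc i) → ps i })
      (p Fin.zero) (eventually-all (p ∘ Fin.suc))

  Continuousᵣ : (Vec → Carrier) → Set
  Continuousᵣ f = ∀ x {ε} → 0# < ε → Eventually x (λ y → Near ε (f x) (f y))

  coordinate-continuous : ∀ i → Continuousᵣ (λ x → x i)
  coordinate-continuous i x {ε} 0<ε = ε , 0<ε , λ near → near i

  constant-continuous : ∀ c → Continuousᵣ (λ _ → c)
  constant-continuous c x 0<ε = always λ _ → near-refl 0<ε refl

  module _ {f g : Vec → Carrier} (cf : Continuousᵣ f) (cg : Continuousᵣ g) where

    +-continuous : Continuousᵣ (λ x → f x + g x)
    +-continuous x {ε} 0<ε = let δ , 0<δ , δ+δ≈ε = half 0<ε in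
      eventually₂ (λ (p , p′) (q , q′) → add δ+δ≈ε p q , add δ+δ≈ε p′ q′) (cf x 0<δ) (cg x 0<δ)
      where
      open SemiringSolver commutativeSemiring
      add : ∀ {δ w x y z} → δ + δ ≈ ε → w < x + δ → y < z + δ → w + y < x + z + ε
      add {δ} {w} {x} {y} {z} δ+δ≈ε p q = begin-strict
        w + y             <⟨ +-mono-< p q ⟩
        x + δ + (z + δ)   ≈⟨ solve 3 (λ x z δ → x :+ δ :+ (z :+ δ) := x :+ z :+ (δ :+ δ)) refl x z δ ⟩
        x + z + (δ + δ)   ≈⟨ +-congˡ δ+δ≈ε ⟩
        x + z + ε         ∎

    ⊔-continuous : Continuousᵣ (λ x → f x ⊔ g x)
    ⊔-continuous x {ε} 0<ε =
      eventually₂ (λ (p , p′) (q , q′) → join p q , join p′ q′) (cf x 0<ε) (cg x 0<ε)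
      where
      join : ∀ {w x y z} → w < x + ε → y < z + ε → w ⊔ y < x ⊔ z + ε
      join {w} {x} {y} {z} p q with ≤.total y w
      ... | inj₁ _ = <-≤-trans p (+-monoˡ-≤ ε (x≤x⊔y x z))
      ... | inj₂ _ = <-≤-trans q (+-monoˡ-≤ ε (x≤y⊔x x z))

    ⊓-continuous : Continuousᵣ (λ x → f x ⊓ g x)
    ⊓-continuous x {ε} 0<ε =
      eventually₂ (λ (p , p′) (q , q′) → meet p q , meet p′ q′) (cf x 0<ε) (cg x 0<ε)
      where
      meet : ∀ {w x y z} → w < x + ε → y < z + ε → w ⊓ y < x ⊓ z + ε
      meet {w} {x} {y} {z} p q with ≤.total x z
      ... | inj₁ _ = ≤-<-trans (x⊓y≤x w y) p
      ... | inj₂ _ = ≤-<-trans (x⊓y≤y w y) q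

    -- With δ half of `g x - f x`, near `x` the function `f` rises by less than δ and `g` drops by
    -- less than δ.
    eventually-< : ∀ {x} → f x < g x → Eventually x (λ y → f y < g y)
    eventually-< {x} fx<gx = let δ , 0<δ , δ+δ≈ε = half (0<y-x fx<gx) in
      eventually₂ (λ (_ , p) (q , _) → +-cancelʳ-< δ (<-≤-trans (+-monoˡ-< δ p) (≤.trans (step δ+δ≈ε) (proj₁ q))))
        (cf x 0<δ) (cg x 0<δ)
      where
      step : ∀ {δ} → δ + δ ≈ g x - f x → f x + δ + δ ≤ g x
      step {δ} eq = ≤.reflexive (trans (+-assoc (f x) δ δ) (trans (+-congˡ eq) (x+[y-x]≈y (f x) (g x))))

  -‿continuous : ∀ {f} → Continuousᵣ f → Continuousᵣ (λ x → - f x)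
  -‿continuous {f} cf x {ε} 0<ε = eventually-map (λ (p , q) → flip q , flip p) (cf x 0<ε)
    where
    flip : ∀ {x y} → x < y + ε → - y < - x + ε
    flip {x} {y} x<y+ε = +-cancelʳ-< (x + y) (begin-strict
      - y + (x + y)     ≈⟨ +-comm (- y) (x + y) ⟩
      x + y - y         ≈⟨ x+y-y≈x x y ⟩
      x                 <⟨ x<y+ε ⟩
      y + ε             ≈⟨ +-congʳ (+-identityˡ y) ⟨
      0# + y + ε        ≈⟨ +-congʳ (+-congʳ (-‿inverseˡ x)) ⟨
      - x + x + y + ε   ≈⟨ solve 4 (λ m x y ε → m :+ x :+ y :+ ε := m :+ ε :+ (x :+ y)) refl (- x) x y ε ⟩
      - x + ε + (x + y) ∎)
      where open SemiringSolver commutativeSemiring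

  module _ {A : Set} {f : A → Vec → Carrier} (cf : ∀ a → Continuousᵣ (f a)) where

    sum-continuous : ∀ as → Continuousᵣ (λ x → sum (map (λ a → f a x) as))
    sum-continuous []       = constant-continuous 0#
    sum-continuous (a ∷ as) = +-continuous (cf a) (sum-continuous as)

    max₀-continuous : ∀ as → Continuousᵣ (λ x → max₀ (λ a → f a x) as)
    max₀-continuous []       = constant-continuous 0#
    max₀-continuous (a ∷ as) = ⊔-continuous (cf a) (max₀-continuous as)

    min₁-continuous : ∀ as → Continuousᵣ (λ x → min₁ (λ a → f a x) as)
    min₁-continuous []       = constant-continuous 1#
    min₁-continuous (a ∷ as) = ⊓-continuous (cf a) (min₁-continuous as)

  -- Points with equal coordinates lie in each other's balls of every radius, so their values are
  -- closer than every ε. Congruence thus comes from continuity, without separate proofs for sums,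
  -- maxima and minima.
  continuous⇒cong : ∀ {f} → Continuousᵣ f → ∀ {x y} → (∀ i → x i ≈ y i) → f x ≈ f y
  continuous⇒cong {f} cf {x} {y} x≈y =
    ≤.antisym (≤+ε⇒≤ (proj₁ ∘ near)) (≤+ε⇒≤ (proj₂ ∘ near))
    where
    near : ∀ {ε} → 0# < ε → Near ε (f x) (f y)
    near 0<ε = let _ , 0<δ , p = cf x 0<ε in p λ i → near-refl 0<δ (x≈y i)

-- Continuity at a point, and running the contraction of a subspace.

module Topology (em : Classical) (ℝ : Reals) (n : ℕ) (X : Space) where
  open Reals ℝ using (0#; 1#; 0≤1; _≤_) renaming (_≈_ to _≈ᵣ_)
  open RealFunctions em ℝ n
  private
    module X = Space X
  open Setoid X.setoid using () renaming (refl to ≈-refl; sym to ≈-sym; trans to ≈-trans)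

  -- Continuity is treated point by point because the contraction that is run completely varies with
  -- the point.
  ContinuousAt : (Vec → X.Carrier) → Pred Vec _
  ContinuousAt f x = ∀ {P} → X.Open P → P (f x) → Eventually x (P ∘ f)

  const-continuousAt : ∀ {c x} → ContinuousAt (λ _ → c) x
  const-continuousAt _ p = always λ _ → p

  -- Lets the map be replaced, near one point, by a constant, by its previous stage or by a single
  -- `push`.
  continuousAt-resp : ∀ {f g x} → Eventually x (λ y → f y X.≈ g y) → ContinuousAt g x → ContinuousAt f x
  continuousAt-resp f≈g cg oP p =
    eventually₂ (λ e → X.respects oP (≈-sym e)) f≈g (cg oP (X.respects oP (eventually-self f≈g) p))

  Time : Set
  Time = Space.Carrier (UnitInterval ℝ)

  -- Needed for the intersection over the empty family, which is formally a subspace but contains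
  -- every point.
  contractible-full : ∀ {A : Pred X.Carrier 0ℓ} → (∀ x → A x) → Contractible ℝ X →
                      Contractible ℝ (subspace X A)
  contractible-full full c = record
    { centre   = centre , full centre
    ; homotopy = record
      { func     = record { to = λ ((x , _) , t) → to (x , t) , full _ ; cong = cong }
      ; preimage = λ (Q , oQ , P⊆Q , Q⊆P) p →
          let P₁ , P₂ , o₁ , o₂ , p₁ , p₂ , box = preimage oQ (P⊆Q p)
          in P₁ ∘ proj₁ , P₂ , (P₁ , o₁ , (λ q → q) , (λ q → q)) , o₂ , p₁ , p₂ ,
             λ q₁ q₂ → Q⊆P (box q₁ q₂)
      }
    ; at-0 = at-0 ∘ proj₁
    ; at-1 = at-1 ∘ proj₁
    }
    where
    open Contractible c
    open Continuous homotopy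

  module _ {A : Pred X.Carrier 0ℓ} (c : Contractible ℝ (subspace X A)) where
    open Contractible c
    open Continuous homotopy

    -- Outside A the value is junk, but independent of the point, so that
    -- 'push-at-1' holds everywhere.
    push : X.Carrier → Time → X.Carrier
    push x t with em {P = A x}
    ... | yes a = proj₁ (to ((x , a) , t))
    ... | no  _ = proj₁ centre

    push-∈ : ∀ x t → A (push x t)
    push-∈ x t with em {P = A x}
    ... | yes a = proj₂ (to ((x , a) , t))
    ... | no  _ = proj₂ centre

    -- Since `A` respects equality, equal points fall into the same branch of `push`.
    push-cong : A Respects X._≈_ → ∀ {x y s t} → x X.≈ y → proj₁ s ≈ᵣ proj₁ t → push x s X.≈ push y t
    push-cong resp {x} {y} x≈y s≈t with em {P = A x} | em {P = A y}
    ... | yes _ | yes _  = cong (x≈y , s≈t)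
    ... | yes a | no  ¬b = contradiction (resp x≈y a) ¬b
    ... | no ¬a | yes b  = contradiction (resp (≈-sym x≈y) b) ¬a
    ... | no _  | no _   = ≈-refl

    push-at-0 : ∀ {x t} → A x → proj₁ t ≈ᵣ 0# → push x t X.≈ x
    push-at-0 {x} a t≈0 with em {P = A x}
    ... | yes a = ≈-trans (cong (≈-refl , t≈0)) (at-0 (x , a))
    ... | no ¬a = contradiction a ¬a

    push-at-1 : ∀ {x t} → proj₁ t ≈ᵣ 1# → push x t X.≈ proj₁ centre
    push-at-1 {x} t≈1 with em {P = A x}
    ... | yes a = ≈-trans (cong (≈-refl , t≈1)) (at-1 (x , a))
    ... | no _  = ≈-refl

    -- The homotopy is continuous only on `A`, so `f` has to stay in `A` near `x`. A box around the
    -- image of `x` inside the preimage of `P` then catches the point and the time belonging to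
    -- every nearby `y`.
    push-continuousAt : ∀ {f t x} → ContinuousAt f x → Continuousᵣ (proj₁ ∘ t) →
                        Eventually x (A ∘ f) → ContinuousAt (λ y → push (f y) (t y)) x
    push-continuousAt {f} {t} {x} cf ct near {P} oP p with em {P = A (f x)}
    ... | no ¬a = contradiction (eventually-self near) ¬a
    ... | yes a with preimage (P , oP , (λ q → q) , (λ q → q)) p
    ...   | _ , _ , (P₁ , o₁ , to₁ , from₁) , (P₂ , lift o₂ , to₂ , from₂) , p₁ , p₂ , box
      -- The time side of the box is the trace of an open set of the line, which supplies the radius
      -- to use in the continuity of `t`.
      with o₂ (to₂ p₂)
    ...   | _ , 0<ε , ball = eventually₂ inside (eventually₂ _,_ near (cf o₁ (to₁ p₁)))
                               (eventually-map ball (ct x 0<ε))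
      where
      inside : ∀ {y} → A (f y) × P₁ (f y) → P₂ (proj₁ (t y)) → P (push (f y) (t y))
      inside {y} (a′ , q₁) q₂ with em {P = A (f y)}
      ... | yes b = box (from₁ {f y , b} q₁) (from₂ {t y} q₂)
      ... | no ¬b = contradiction a′ ¬b

-- Enumeration of sublists.

module _ {A : Set} where

  sublists : List A → List (List A)
  sublists []       = [ [] ]
  sublists (x ∷ xs) = sublists xs ++ map (x ∷_) (sublists xs)

  filter∈sublists : ∀ {P : Pred A 0ℓ} (P? : Decidable P) xs → filter P? xs ∈ sublists xs
  filter∈sublists P? []       = here ≡.refl
  filter∈sublists P? (x ∷ xs) with P? x
  ... | yes _ = ∈-++⁺ʳ (sublists xs) (∈-map⁺ (x ∷_) (filter∈sublists P? xs))
  ... | no  _ = ∈-++⁺ˡ (filter∈sublists P? xs)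

-- The convex sets and their nerve.

module Construction (em : Classical) (ℝ : Reals) {n : ℕ} (K : SimplicialComplex (Fin n)) where
  open Reals ℝ
  open OrderedField em ℝ
  open RealFunctions em ℝ n
  open SimplicialComplex K

  NonFace : Pred (List (Fin n)) 0ℓ
  NonFace τ = τ ≢ [] × ¬ Face τ

  -- Being a face depends only on the set of members, so one list per set is enough: the sublists of
  -- `allFin n`. This makes the conditions on the convex sets finite in number.
  nonFaces : List (List (Fin n))
  nonFaces = filter (λ τ → em {P = NonFace τ}) (sublists (allFin n))

  ∈nonFaces⇒NonFace : ∀ {τ} → τ ∈ nonFaces → NonFace τ
  ∈nonFaces⇒NonFace = proj₂ ∘ ∈-filter⁻ (λ τ → em) {xs = sublists (allFin n)}

  filter∈nonFaces : ∀ {P : Pred (Fin n) 0ℓ} (P? : Decidable P) →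
                    NonFace (filter P? (allFin n)) → filter P? (allFin n) ∈ nonFaces
  filter∈nonFaces P? = ∈-filter⁺ (λ τ → em) (filter∈sublists P? (allFin n))

  -- A coordinate within 2 of one threshold must not be within 2 of another
  -- one, hence a step greater than 4.
  2# step : Carrier
  2# = 1# + 1#
  step = 2# + 2# + 1#

  0≤2 : 0# ≤ 2#
  0≤2 = ≤.trans 0≤1 (x≤x+y 0≤1)

  threshold : ℕ → Carrier
  threshold zero    = 0#
  threshold (suc k) = threshold k + step

  threshold-suc : ∀ k → threshold k ≤ threshold (suc k)
  threshold-suc k = x≤x+y (≤.trans 0≤2 (≤.trans (x≤x+y 0≤2) (x≤x+y 0≤1)))

  threshold-mono : ∀ {j k} → j ℕ.≤′ k → threshold j ≤ threshold k
  threshold-mono             (ℕ.≤′-reflexive ≡.refl) = ≤.refl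
  threshold-mono {k = suc k} (ℕ.≤′-step j≤k)         = ≤.trans (threshold-mono j≤k) (threshold-suc k)

  0≤threshold : ∀ k → 0# ≤ threshold k
  0≤threshold k = threshold-mono (ℕ.≤⇒≤′ (ℕ.z≤n {k}))

  -- Lies above the thresholds 0 to n used by the stages of the map, so that `i` belongs to every
  -- superlevel set of a point of `C i`.
  top : Carrier
  top = threshold (suc n)

  C : Fin n → Pred Vec 0ℓ
  C i x = top ≤ x i × (∀ {τ} → τ ∈ nonFaces → sum (map x τ) ≤ - 1#)

  C-convex : ∀ i → IsConvexSet ℝ (C i)
  C-convex i = record
    { respects = λ x≈y (top≤ , sum≤) →
        ≤.trans top≤ (≤.reflexive (x≈y i)) ,
        λ {τ} τ∈ → ≤.trans (sum-mono-≤ (≤.reflexive ∘ sym ∘ x≈y) τ) (sum≤ τ∈)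
    ; convex = λ {x} {y} (top≤x , sumx≤) (top≤y , sumy≤) {t} 0≤t t≤1 →
        ≤.trans (≤.reflexive (sym mix)) (mix-mono 0≤t t≤1 top≤x top≤y) ,
        λ {τ} τ∈ → ≤.trans (≤.reflexive (sum-mix (1# - t) t x y τ))
          (≤.trans (mix-mono 0≤t t≤1 (sumx≤ τ∈) (sumy≤ τ∈)) (≤.reflexive mix))
    }

  -1<0 : - 1# < 0#
  -1<0 = begin-strict
    - 1#      <⟨ x<x+y 0<1 ⟩
    - 1# + 1# ≈⟨ -‿inverseˡ 1# ⟩
    0#        ∎

  excess : Vec → List (Fin n) → Carrier
  excess x τ = sum (map x τ) + 1#

  defect : Vec → Carrier
  defect x = max₀ (excess x) nonFaces

  -- The bound -1 in `C` makes every excess at most 0 there, so subtracting the defect does not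
  -- lower the coordinates below `top`.
  defect≤0 : ∀ {i x} → C i x → defect x ≤ 0#
  defect≤0 {i} {x} (_ , sum≤) = max₀≤0 (excess x) nonFaces λ τ∈ →
    ≤.trans (+-monoˡ-≤ 1# (sum≤ τ∈)) (≤.reflexive (-‿inverseˡ 1#))

  -- At a common point the coordinates in `τ` are at least `top`, hence their sum is nonnegative;
  -- for a nonface it would be at most -1.
  nerve⊆K : ∀ {τ} → SimplicialComplex.Face (Nerve C) τ → Face τ
  nerve⊆K {[]}    (τ≢[] , _)    = contradiction ≡.refl τ≢[]
  nerve⊆K {τ@(i ∷ _)} (τ≢[] , x , x∈) with em {P = Face τ}
  ... | yes face  = face
  ... | no  ¬face = contradiction
    (sum-nonneg τ′ λ j∈τ′ → ≤.trans (0≤threshold (suc n)) (proj₁ (x∈ (τ′⊆τ j∈τ′))))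
    (<⇒≱ (≤-<-trans (proj₂ (x∈ (here ≡.refl)) τ′∈) -1<0))
    where
    ∈τ? : Decidable (_∈ τ)
    ∈τ? j = em
    -- `τ` may permute or repeat vertices; `nonFaces` can only contain its reordering along
    -- `allFin n`.
    τ′ : List (Fin n)
    τ′ = filter ∈τ? (allFin n)
    τ′⊆τ : ∀ {j} → j ∈ τ′ → j ∈ τ
    τ′⊆τ = proj₂ ∘ ∈-filter⁻ ∈τ? {xs = allFin n}
    τ⊆τ′ : ∀ {j} → j ∈ τ → j ∈ τ′
    τ⊆τ′ {j} = ∈-filter⁺ ∈τ? (∈-allFin j)
    τ′∈ : τ′ ∈ nonFaces
    τ′∈ = filter∈nonFaces ∈τ?
      ( (λ τ′≡[] → contradiction (≡.subst (i ∈_) τ′≡[] (τ⊆τ′ (here ≡.refl))) λ ())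
      , ¬face ∘ downClosed τ≢[] τ⊆τ′)

  -- A point of ⋂_{i∈σ} Cᵢ: its coordinates outside σ are so low that one of
  -- them outweighs all the others.
  module Apex (σ : List (Fin n)) (face : Face σ) where
    depth : Carrier
    depth = defect (λ _ → top)

    apex : Vec
    apex i with em {P = i ∈ σ}
    ... | yes _ = top
    ... | no  _ = - depth

    apex-∈ : ∀ {i} → i ∈ σ → top ≤ apex i
    apex-∈ {i} i∈σ with em {P = i ∈ σ}
    ... | yes _   = ≤.refl
    ... | no  i∉σ = contradiction i∈σ i∉σ

    apex-∉ : ∀ {i} → i ∉ σ → apex i ≤ - depth
    apex-∉ {i} i∉σ with em {P = i ∈ σ}
    ... | yes i∈σ = contradiction i∈σ i∉σ
    ... | no  _   = ≤.refl

    apex≤top : ∀ i → apex i ≤ top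
    apex≤top i with em {P = i ∈ σ}
    ... | yes _ = ≤.refl
    ... | no  _ = begin
      - depth         ≤⟨ x≤x+y (0≤max₀ (excess (λ _ → top)) nonFaces) ⟩
      - depth + depth ≈⟨ -‿inverseˡ depth ⟩
      0#              ≤⟨ 0≤threshold (suc n) ⟩
      top             ∎

    -- A nonface has a member `j` outside `σ`. Its coordinate is at most `- depth`, while the other
    -- coordinates are at most `top`, and `depth` bounds the excess of `τ` at the point with all
    -- coordinates `top`.
    sum-apex : ∀ {τ} → τ ∈ nonFaces → sum (map apex τ) ≤ - 1#
    sum-apex {τ} τ∈ with em {P = ∃ λ j → j ∈ τ × j ∉ σ}
    ... | no ¬∃ = let τ≢[] , ¬face = ∈nonFaces⇒NonFace τ∈ in contradiction (downClosed τ≢[] τ⊆σ face) ¬face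
      where
      τ⊆σ : ∀ {j} → j ∈ τ → j ∈ σ
      τ⊆σ {j} j∈τ with em {P = j ∈ σ}
      ... | yes j∈σ = j∈σ
      ... | no  j∉σ = contradiction (j , j∈τ , j∉σ) ¬∃
    ... | yes (j , j∈τ , j∉σ) = +-cancelʳ-≤ 1# (begin
      sum (map apex τ) + 1#                       ≤⟨ +-monoˡ-≤ 1# (sum≤ j∈τ (λ _ → 0≤threshold (suc n)) apex≤top) ⟩
      apex j + sum (map (λ _ → top) τ) + 1#       ≈⟨ +-assoc _ _ _ ⟩
      apex j + (sum (map (λ _ → top) τ) + 1#)     ≤⟨ +-mono-≤ (apex-∉ j∉σ) (≤max₀ (excess (λ _ → top)) τ∈) ⟩
      - depth + depth                             ≈⟨ -‿inverseˡ depth ⟩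
      0#                                          ≈⟨ -‿inverseˡ 1# ⟨
      - 1# + 1#                                   ∎)

  K⊆nerve : ∀ {σ} → Face σ → SimplicialComplex.Face (Nerve C) σ
  K⊆nerve {σ} face = nonempty face , apex , λ i∈σ → apex-∈ i∈σ , sum-apex
    where open Apex σ face

  -- Superlevel sets and running times.

  level : ℕ → Vec → Carrier
  level k x = defect x + threshold k

  -- The defect is added to the thresholds instead of being subtracted from the coordinates.
  Above : ℕ → Vec → Pred (Fin n) 0ℓ
  Above k x i = level k x ≤ x i

  above? : ∀ k x → Decidable (Above k x)
  above? k x i = em

  above : ℕ → Vec → List (Fin n)
  above k x = filter (above? k x) (allFin n)

  ∈above⁺ : ∀ {k x i} → Above k x i → i ∈ above k x
  ∈above⁺ {k} {x} {i} = ∈-filter⁺ (above? k x) (∈-allFin i)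

  ∈above⁻ : ∀ {k x i} → i ∈ above k x → Above k x i
  ∈above⁻ {k} {x} = proj₂ ∘ ∈-filter⁻ (above? k x) {xs = allFin n}

  -- Equality as lists is wanted because the good cover may choose different contractions for two
  -- lists with the same members.
  above-cong : ∀ {k x y} → (∀ i → (Above k x i → Above k y i) × (Above k y i → Above k x i)) →
               above k x ≡ above k y
  above-cong {k} {x} {y} same =
    filter-≐ (above? k x) (above? k y) ((λ {i} → proj₁ (same i)) , (λ {i} → proj₂ (same i))) (allFin n)

  above-suc : ∀ {k x i} → Above (suc k) x i → Above k x i
  above-suc {k} = ≤.trans (+-monoʳ-≤ _ (threshold-suc k))

  -- All coordinates in the superlevel set are at least `defect x`, which is nonnegative, so if the
  -- set is nonempty their sum is too. For a nonface the defect would be at least this sum plus 1.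
  above-face : ∀ k x → above k x ≡ [] ⊎ Face (above k x)
  above-face k x with em {P = NonFace (above k x)} | em {P = above k x ≡ []} | em {P = Face (above k x)}
  ... | _ | yes ≡[] | _        = inj₁ ≡[]
  ... | _ | no  _   | yes face = inj₂ face
  ... | no ¬nonFace | no ≢[] | no ¬face = contradiction (≢[] , ¬face) ¬nonFace
  ... | yes nonFace | no _ | no _ = contradiction
    (begin
      excess x (above k x)    ≤⟨ ≤max₀ (excess x) (filter∈nonFaces (above? k x) nonFace) ⟩
      defect x                ≤⟨ ≤sum (above k x) (proj₁ nonFace) (0≤max₀ (excess x) nonFaces)
                                   (λ i∈ → ≤.trans (x≤x+y (0≤threshold k)) (∈above⁻ {k} {x} i∈)) ⟩
      sum (map x (above k x)) ∎)
    (<⇒≱ (x<x+y 0<1))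

  -- ∣ x i - level k x ∣ - 1
  gap : ℕ → Vec → Fin n → Carrier
  gap k x i = (x i - (level k x + 1#)) ⊔ (level k x - (x i + 1#))

  -- It is 0 if some coordinate is within 1 of the level, and 1 if all are at distance at least 2.
  time : ℕ → Vec → Carrier
  time k x = 0# ⊔ min₁ (gap k x) (allFin n)

  level-continuous : ∀ k → Continuousᵣ (level k)
  level-continuous k = +-continuous (max₀-continuous excess-continuous nonFaces) (constant-continuous (threshold k))
    where
    excess-continuous : ∀ τ → Continuousᵣ (λ x → excess x τ)
    excess-continuous τ = +-continuous (sum-continuous coordinate-continuous τ) (constant-continuous 1#)

  time-continuous : ∀ k → Continuousᵣ (time k)
  time-continuous k = ⊔-continuous (constant-continuous 0#) (min₁-continuous gap-continuous (allFin n))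
    where
    shifted : ∀ {f g} → Continuousᵣ f → Continuousᵣ g → Continuousᵣ (λ x → f x - (g x + 1#))
    shifted cf cg = +-continuous cf (-‿continuous (+-continuous cg (constant-continuous 1#)))
    gap-continuous : ∀ i → Continuousᵣ (λ x → gap k x i)
    gap-continuous i = ⊔-continuous
      (shifted (coordinate-continuous i) (level-continuous k))
      (shifted (level-continuous k) (coordinate-continuous i))

  time∈[0,1] : ∀ k x → 0# ≤ time k x × time k x ≤ 1#
  time∈[0,1] k x = x≤x⊔y 0# _ , ⊔-lub 0≤1 (min₁≤1 (gap k x) (allFin n))

  -- Strict inequalities, so that the condition persists nearby. With c = 0 it says that the
  -- coordinate is off the level; with c = 2 it forces the full running time.
  Far : Carrier → ℕ → Vec → Pred (Fin n) 0ℓ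
  Far c k x i = level k x + c < x i ⊎ x i + c < level k x

  eventually-far : ∀ {c k x i} → Far c k x i → Eventually x (λ y → Far c k y i)
  eventually-far {c} {k} {i = i} (inj₁ p) = eventually-map inj₁
    (eventually-< (+-continuous (level-continuous k) (constant-continuous c)) (coordinate-continuous i) p)
  eventually-far {c} {k} {i = i} (inj₂ p) = eventually-map inj₂
    (eventually-< (+-continuous (coordinate-continuous i) (constant-continuous c)) (level-continuous k) p)

  ¬far⇒close : ∀ {c k x i} → ¬ Far c k x i → x i ≤ level k x + c × level k x ≤ x i + c
  ¬far⇒close {c} {k} {x} {i} ¬f with em {P = x i ≤ level k x + c} | em {P = level k x ≤ x i + c}
  ... | yes p | yes q = p , q
  ... | no ¬p | _     = contradiction (inj₁ (≰⇒> ¬p)) ¬f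
  ... | _     | no ¬q = contradiction (inj₂ (≰⇒> ¬q)) ¬f

  Reset : ℕ → Pred Vec 0ℓ
  Reset k x = ∀ i → Far 2# k x i

  time-reset : ∀ {k x} → Reset k x → time k x ≈ 1#
  time-reset {k} {x} r = ≤.antisym (proj₂ (time∈[0,1] k x))
    (≤.trans (1≤min₁ (gap k x) (allFin n) λ i → 1≤gap i (r i)) (x≤y⊔x 0# _))
    where
    open SemiringSolver commutativeSemiring
    far⇒1≤ : ∀ {p q} → p + 2# < q → 1# ≤ q - (p + 1#)
    far⇒1≤ {p} p+2<q = x≤z-y (≤.trans
      (≤.reflexive (solve 1 (λ p → con 1 :+ (p :+ con 1) := p :+ (con 1 :+ con 1)) refl p)) (proj₁ p+2<q))
    1≤gap : ∀ i → Far 2# k x i → 1# ≤ gap k x i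
    1≤gap i (inj₁ p) = ≤.trans (far⇒1≤ p) (x≤x⊔y _ _)
    1≤gap i (inj₂ p) = ≤.trans (far⇒1≤ p) (x≤y⊔x _ _)

  time-close : ∀ {k x i} → x i < level k x + 1# → level k x < x i + 1# → time k x ≈ 0#
  time-close {k} {x} {i} p q = ≤.antisym
    (⊔-lub ≤.refl (≤.trans (min₁≤ (gap k x) (∈-allFin i)) (⊔-lub (x-y≤0 (proj₁ p)) (x-y≤0 (proj₁ q)))))
    (proj₁ (time∈[0,1] k x))

  -- Membership in a superlevel set can change only where a coordinate meets the level.
  above-locally-constant : ∀ {k x} → (∀ i → Far 0# k x i) → Eventually x (λ y → above k y ≡ above k x)
  above-locally-constant {k} {x} far =
    eventually-map (above-cong {k}) (eventually-all λ i → side (far i))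
    where
    +0 : ∀ {y z} → y + 0# < z → y < z
    +0 y+0<z = ≤-<-trans (≤.reflexive (sym (+-identityʳ _))) y+0<z
    side : ∀ {i} → Far 0# k x i →
           Eventually x (λ y → (Above k y i → Above k x i) × (Above k x i → Above k y i))
    side {i} (inj₁ p) = eventually-map (λ q → (λ _ → proj₁ (+0 p)) , (λ _ → proj₁ q))
      (eventually-< (level-continuous k) (coordinate-continuous i) (+0 p))
    side {i} (inj₂ p) = eventually-map
      (λ q → (λ a → contradiction a (<⇒≱ q)) , (λ a → contradiction a (<⇒≱ (+0 p))))
      (eventually-< (coordinate-continuous i) (level-continuous k) (+0 p))

  -- Otherwise each of the n + 1 levels has one of the n coordinates within 2 of it, and two levels
  -- share a coordinate. They would be at most 4 apart, but `step` is 5.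
  ∃-reset : ∀ x → ∃ λ k → k ℕ.< suc n × Reset k x
  ∃-reset x with em {P = ∃ λ k → k ℕ.< suc n × Reset k x}
  ... | yes r = r
  ... | no ¬r = contradiction collide (λ ())
    where
    open SemiringSolver commutativeSemiring
    blocked : ∀ (k : Fin (suc n)) → ∃ λ i → ¬ Far 2# (toℕ k) x i
    blocked k = ¬∀⟶∃¬ n _ (λ _ → em) λ r → ¬r (toℕ k , toℕ<n k , r)
    separated : ∀ {j k i} → j ℕ.< k → ¬ Far 2# j x i → ¬ Far 2# k x i → ⊥
    separated {j} {k} {i} j<k ¬fj ¬fk = <⇒≱ (x<x+y 0<1) (begin
      level j x + 2# + 2# + 1# ≈⟨ solve 3 (λ d t u → d :+ t :+ u :+ u :+ con 1 := d :+ (t :+ (u :+ u :+ con 1)))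
                                    refl (defect x) (threshold j) 2# ⟩
      level (suc j) x          ≤⟨ +-monoʳ-≤ _ (threshold-mono (ℕ.≤⇒≤′ j<k)) ⟩
      level k x                ≤⟨ proj₂ (¬far⇒close {k = k} ¬fk) ⟩
      x i + 2#                 ≤⟨ +-monoˡ-≤ 2# (proj₁ (¬far⇒close {k = j} ¬fj)) ⟩
      level j x + 2# + 2#      ∎)
    collide : ⊥
    collide with pigeonhole (ℕ.n<1+n n) (proj₁ ∘ blocked)
    ... | j , k , j<k , eq = separated j<k (proj₂ (blocked j))
      (≡.subst (λ i → ¬ Far 2# (toℕ k) x i) (≡.sym eq) (proj₂ (blocked k)))

  -- The map and its continuity.

  module _ (X : Space) (contractible : Contractible ℝ X) (S : Fin n → Pred (Space.Carrier X) 0ℓ)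
           (cover : IsGoodCover ℝ X S) (K⊆N : IsSubcomplex K (Nerve S)) where
    open Topology em ℝ n X
    private module X = Space X
    open Setoid X.setoid using ()
      renaming (reflexive to ≈-reflexive; refl to ≈-refl; sym to ≈-sym; trans to ≈-trans)
    open IsGoodCover cover using (respects; intersection)

    -- The good cover speaks of nonempty families only; over the empty one the intersection is `X`,
    -- contractible by assumption.
    contraction : ∀ σ → Empty (⋂[ σ ] S) ⊎ Contractible ℝ (subspace X (⋂[ σ ] S))
    contraction []      = inj₂ (contractible-full (λ _ ()) contractible)
    contraction (i ∷ σ) = intersection (i ∷ σ) λ ()

    -- The case of an empty intersection is excluded by 'above-face'.
    move : List (Fin n) → X.Carrier → Time → X.Carrier
    move σ p t with contraction σ
    ... | inj₁ _ = p
    ... | inj₂ c = push c p t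

    -- A face of `K` is a face of the nerve of `S`, which supplies a point of the intersection.
    move-push : ∀ {σ} → σ ≡ [] ⊎ Face σ →
                Σ (Contractible ℝ (subspace X (⋂[ σ ] S))) λ c → ∀ p t → move σ p t ≡ push c p t
    move-push {σ} adm with contraction σ in eq
    ... | inj₂ c = c , λ _ _ → ≡.refl
    -- `contraction []` is an `inj₂` by definition, so the remembered equation is absurd.
    move-push {_} (inj₁ ≡.refl) | inj₁ empty = contradiction eq λ ()
    move-push {_} (inj₂ face) | inj₁ empty = ⊥-elim (empty _ (proj₂ (proj₂ (K⊆N face))))

    timeᵢ : ℕ → Vec → Time
    timeᵢ k x = time k x , time∈[0,1] k x

    -- `route (suc k)` is the position after stage `k`. The starting point is arbitrary, since some
    -- stage forgets it.
    route : ℕ → Vec → X.Carrier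
    route zero    x = Contractible.centre contractible
    route (suc k) x = move (above k x) (route k x) (timeᵢ k x)

    -- One contraction serves all `y` with the same superlevel set as `x`, in particular all `y`
    -- near `x` where that set is locally constant.
    route-push : ∀ k x → Σ (Contractible ℝ (subspace X (⋂[ above k x ] S))) λ c →
                 ∀ {y} → above k y ≡ above k x → route (suc k) y X.≈ push c (route k y) (timeᵢ k y)
    route-push k x = let c , eq = move-push (above-face k x) in
      c , λ {y} same → ≈-reflexive (≡.trans (≡.cong (λ σ → move σ (route k y) (timeᵢ k y)) same) (eq _ _))

    -- Stage `k` ends in the intersection over the k-th superlevel set whatever the time spent, and
    -- the next superlevel set is contained in that one. Hence the position lies where the next
    -- contraction is defined.
    route-∈ : ∀ {k x i} → Above (suc k) x i → S i (route (suc k) x)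
    route-∈ {k} {x} {i} a = let c , eq = route-push k x in
      respects i (≈-sym (eq ≡.refl)) (push-∈ c _ _ (∈above⁺ {k} {x} (above-suc {k} {x} a)))

    route-∈⋂ : ∀ k x → (⋂[ above (suc k) x ] S) (route (suc k) x)
    route-∈⋂ k x i∈ = route-∈ {k} (∈above⁻ {suc k} {x} i∈)

    route-cong : ∀ k {x y} → (∀ i → x i ≈ y i) → route k x X.≈ route k y
    route-cong zero    x≈y = ≈-refl
    route-cong (suc k) {x} {y} x≈y = let c , eq = route-push k x in
      ≈-trans (eq ≡.refl) (≈-trans
        (push-cong c (λ p≈q p∈ i∈σ → respects _ p≈q (p∈ i∈σ))
          (route-cong k x≈y) (continuous⇒cong (time-continuous k) x≈y))
        (≈-sym (eq (above-cong {k} λ i → transport (sym ∘ x≈y) , transport x≈y))))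
      where
      transport : ∀ {x y i} → (∀ i → x i ≈ y i) → Above k x i → Above k y i
      transport x≈y a = ≤.trans (≤.reflexive (continuous⇒cong (level-continuous k) (sym ∘ x≈y)))
        (≤.trans a (≤.reflexive (x≈y _)))

    -- Near `x` the contraction stays the same and is run completely, so the route is locally
    -- constant, at the centre.
    route-continuousAt-reset : ∀ k {x} → Reset k x → ContinuousAt (route (suc k)) x
    route-continuousAt-reset k {x} r = let c , eq = route-push k x in continuousAt-resp
      (eventually₂ (λ {y} same r′ → ≈-trans (eq same) (push-at-1 c (time-reset {k} {y} r′)))
        (above-locally-constant {k} far₀) (eventually-all λ i → eventually-far {k = k} {i = i} (r i)))
      const-continuousAt
      where
      far₀ : ∀ i → Far 0# k x i
      far₀ i with r i
      ... | inj₁ p = inj₁ (≤-<-trans (+-monoʳ-≤ _ 0≤2) p)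
      ... | inj₂ p = inj₂ (≤-<-trans (+-monoʳ-≤ _ 0≤2) p)

    -- If no coordinate is on the next level, a single contraction is run near `x`, for a continuous
    -- time. If some coordinate is on it, the time is 0 near `x` and the stage moves nothing.
    route-continuousAt-suc : ∀ k {x} → ContinuousAt (route (suc k)) x → ContinuousAt (route (2 ℕ.+ k)) x
    route-continuousAt-suc k {x} continuousAt with em {P = ∀ i → Far 0# (suc k) x i}
    ... | yes far =
      let c , eq   = route-push (suc k) x
          constant = above-locally-constant {suc k} far
      in continuousAt-resp (eventually-map eq constant)
           (push-continuousAt c continuousAt (time-continuous (suc k))
             -- Nearby points have the same superlevel set as `x`, so their positions lie in the
             -- domain of the contraction `c` chosen at `x`.
             (eventually-map {Q = (⋂[ above (suc k) x ] S) ∘ route (suc k)}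
               (λ {y} same {i} i∈ → route-∈⋂ k y (≡.subst (i ∈_) (≡.sym same) i∈)) constant))
    ... | no ¬far =
      let i , ¬farᵢ = ¬∀⟶∃¬ n _ (λ _ → em) ¬far
          p , q     = ¬far⇒close {k = suc k} ¬farᵢ
      in continuousAt-resp
           (eventually₂ (still i)
             (eventually-<+1 (coordinate-continuous i) (level-continuous (suc k)) p)
             (eventually-<+1 (level-continuous (suc k)) (coordinate-continuous i) q))
           continuousAt
      where
      eventually-<+1 : ∀ {f g} → Continuousᵣ f → Continuousᵣ g → f x ≤ g x + 0# →
                       Eventually x (λ y → f y < g y + 1#)
      eventually-<+1 cf cg f≤g+0 =
        eventually-< cf (+-continuous cg (constant-continuous 1#)) (≤-<-trans f≤g+0 (+-monoʳ-< _ 0<1))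
      still : ∀ i {y} → y i < level (suc k) y + 1# → level (suc k) y < y i + 1# →
              route (2 ℕ.+ k) y X.≈ route (suc k) y
      still i {y} p q = let c , eq = route-push (suc k) y in
        ≈-trans (eq ≡.refl) (push-at-0 c (route-∈⋂ k y) (time-close {suc k} {y} {i} p q))

    route-continuousAt : ∀ {j k x} → Reset j x → j ℕ.≤′ k → ContinuousAt (route (suc k)) x
    route-continuousAt {j}         r (ℕ.≤′-reflexive ≡.refl) = route-continuousAt-reset j r
    route-continuousAt {k = suc k} r (ℕ.≤′-step j≤k)         =
      route-continuousAt-suc k (route-continuousAt r j≤k)

    route-continuous : Continuous (Euclidean ℝ n) X
    route-continuous = record
      { func     = record { to = route (suc n) ; cong = route-cong (suc n) }
      ; preimage = λ oP → lift λ {x} p →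
          -- The stage that resets has index at most n, and `route (suc n)` is the position after
          -- stage n; continuity is carried over the stages between.
          let _ , k<1+n , r = ∃-reset x in route-continuousAt r (ℕ.≤⇒≤′ (ℕ.≤-pred k<1+n)) oP p
      }

    route-C : ∀ i {x} → C i x → S i (route (suc n) x)
    route-C i {x} x∈C = route-∈ {n} (begin
      defect x + top ≤⟨ +-monoˡ-≤ top (defect≤0 {i} x∈C) ⟩
      0# + top       ≈⟨ +-identityˡ top ⟩
      top            ≤⟨ proj₁ x∈C ⟩
      x i            ∎)

proposition3 : Classical → (ℝ : Reals) →
    ∀ {V : Set} (Y : SimplicialComplex V) (d : ℕ) →
    LocallyFinite Y → HasDimension Y d → Contractible ℝ (polyhedron ℝ Y) →
    ∀ (n : ℕ) (S : Fin n → Pred (Space.Carrier (polyhedron ℝ Y)) 0ℓ) →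
    IsGoodCover ℝ (polyhedron ℝ Y) S →
    ∀ (K : SimplicialComplex (Fin n)) → HasVertexSetAll K → IsSubcomplex K (Nerve S) →
    Σ ℕ λ m →
    Σ (Fin n → Pred (Space.Carrier (Euclidean ℝ m)) 0ℓ) λ C →
    Σ (Continuous (Euclidean ℝ m) (polyhedron ℝ Y)) λ f →
    (∀ i → IsConvexSet ℝ (C i)) ×
    SameComplex (Nerve C) K ×
    (∀ i {x} → C i x → S i (Continuous.to f x))
proposition3 em ℝ Y d _ _ contractible n S cover K _ K⊆N =
  n , C , route-continuous (polyhedron ℝ Y) contractible S cover K⊆N ,
  C-convex , (nerve⊆K , K⊆nerve) , route-C (polyhedron ℝ Y) contractible S cover K⊆N
  where open Construction em ℝ K
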